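{- Let $G$ be a fixed edge-ordered graph with labeling $l$, minimal edge $e_0$ and maximal edge $e_{\max}$. If $ab\in\{e_0,e_{\max}\}$ and there exist two vertices $v,w\in N_G(a)\cap N_G(b)$ such that $l(av)<l(aw)$ and $l(bv)>l(bw)$, then \[sat_e(n,G)\ \ge\ ssat_e(n,G)=\Omega(n\sqrt{\log n}).\]
   Context: An edge-ordered graph is a finite simple graph together with a linear order on its edge set given by an injective labeling $l:E\to\mathbb{N}$ (or $l:E\to\mathbb{R}$). An edge-ordered graph $H$ contains $G$ (has a copy of $G$) if $G$ is isomorphic, by an isomorphism respecting the edge-order, to a subgraph of $H$ with the induced order; otherwise $H$ is $G$-free. The minimal (maximal) edge is the edge with the smallest (largest) label. $N_G(a)$ denotes the open neighborhood of $a$ in $G$. $ssat_e(n,G)$ is the minimum number of edges in an edge-ordered graph $H$ on $n$ vertices such that adding to $H$ any missing edge, inserted at an arbitrary position of the linear order of the edges, creates a new copy of $G$ (one using the added edge); that is, for every missing edge and every position a new copy is created. $sat_e(n,G)$ is defined in the same way with the additional requirement that $H$ is $G$-free. Asymptotic notation is for $n\to\infty$ with $G$ fixed. -}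

module Defs where

open import Data.Bool using (Bool; false; T)
open import Data.Bool.Properties using (T?)
open import Data.Fin using (Fin; _<?_)
open import Data.List using (List; length; filter; allFin; cartesianProduct)
open import Data.Nat using (ℕ; _*_; _≤_; _<_; _≥_; _>_)
open import Data.Nat.Logarithm using (⌊log₂_⌋)
open import Data.Product using (Σ-syntax; ∃-syntax; _×_; _,_)
open import Data.Sum using (_⊎_)
open import Function.Bundles using (_⇔_)
open import Function.Definitions using (Injective)
open import Level using (0ℓ)
open import Relation.Binary.PropositionalEquality using (_≡_; _≢_)
open import Relation.Nullary using (¬_)
open import Relation.Nullary.Decidable using (_×-dec_)
open import Relation.Unary using (Pred)

-- Equality of the unordered pairs {u , v} and {x , y}.
SameEdge : ∀ {n} → (u v x y : Fin n) → Set
SameEdge u v x y = (u ≡ x × v ≡ y) ⊎ (u ≡ y × v ≡ x)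

-- The label is a total function on pairs of vertices for convenience; its
-- values on non-edges carry no information and are never used below.
record EdgeOrderedGraph (n : ℕ) : Set where
  field
    adj        : Fin n → Fin n → Bool
    adj-sym    : ∀ u v → adj u v ≡ adj v u
    adj-irrefl : ∀ u → adj u u ≡ false
    label      : Fin n → Fin n → ℕ
    label-sym  : ∀ u v → label u v ≡ label v u

  Adj : Fin n → Fin n → Set
  Adj u v = T (adj u v)

  field
    label-injective : ∀ {u v x y} → Adj u v → Adj x y →
                      label u v ≡ label x y → SameEdge u v x y

  N : Fin n → Pred (Fin n) 0ℓ
  N a v = Adj a v

  edges : List (Fin n × Fin n)
  edges = filter (λ (u , v) → (u <? v) ×-dec T? (adj u v))
                 (cartesianProduct (allFin n) (allFin n))

  ∣E∣ : ℕ
  ∣E∣ = length edges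

  IsMinimalEdge : Fin n → Fin n → Set
  IsMinimalEdge a b = Adj a b × (∀ x y → Adj x y → label a b ≤ label x y)

  IsMaximalEdge : Fin n → Fin n → Set
  IsMaximalEdge a b = Adj a b × (∀ x y → Adj x y → label x y ≤ label a b)

open EdgeOrderedGraph

-- Copies are subgraphs that need not be induced, so non-edges of G are
-- unconstrained.
record Copy {k n : ℕ} (G : EdgeOrderedGraph k) (H : EdgeOrderedGraph n) : Set where
  field
    map            : Fin k → Fin n
    map-injective  : Injective _≡_ _≡_ map
    preserves-adj  : ∀ {c d} → Adj G c d → Adj H (map c) (map d)
    preserves-order : ∀ {c d c′ d′} → Adj G c d → Adj G c′ d′ →
                      label G c d < label G c′ d′ →
                      label H (map c) (map d) < label H (map c′) (map d′)

  Uses : Fin n → Fin n → Set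
  Uses x y = ∃[ c ] ∃[ d ] Adj G c d × SameEdge (map c) (map d) x y

open Copy

Free : ∀ {k n} → EdgeOrderedGraph k → EdgeOrderedGraph n → Set
Free G H = ¬ Copy G H

-- H⁺ arises from H by inserting the edge xy somewhere in the edge order.
-- Only the relative order of the old edges is fixed: their labels may change
-- (there need not be a free natural number between two labels of H), and the
-- position of xy is whatever its label in H⁺ says.
record IsInsertion {n : ℕ} (H : EdgeOrderedGraph n) (x y : Fin n)
                   (H⁺ : EdgeOrderedGraph n) : Set where
  field
    edges⁺ : ∀ u v → Adj H⁺ u v ⇔ (Adj H u v ⊎ SameEdge u v x y)
    order⁺ : ∀ {u v u′ v′} → Adj H u v → Adj H u′ v′ →
             label H u v < label H u′ v′ → label H⁺ u v < label H⁺ u′ v′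

Semisaturated : ∀ {k n} → EdgeOrderedGraph k → EdgeOrderedGraph n → Set
Semisaturated G H =
  ∀ x y → x ≢ y → ¬ Adj H x y →
  ∀ H⁺ → IsInsertion H x y H⁺ →
  Σ[ φ ∈ Copy G H⁺ ] Uses φ x y

Saturated : ∀ {k n} → EdgeOrderedGraph k → EdgeOrderedGraph n → Set
Saturated G H = Free G H × Semisaturated G H

IsMinimum : Pred ℕ 0ℓ → Pred ℕ 0ℓ
IsMinimum P m = P m × (∀ {k} → P k → m ≤ k)

-- IsSsatₑ n G s and IsSatₑ n G t say that ssatₑ(n,G) = s and satₑ(n,G) = t.
IsSsatₑ : ∀ {k} → ℕ → EdgeOrderedGraph k → ℕ → Set
IsSsatₑ n G = IsMinimum λ m →
  Σ[ H ∈ EdgeOrderedGraph n ] Semisaturated G H × ∣E∣ H ≡ m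

IsSatₑ : ∀ {k} → ℕ → EdgeOrderedGraph k → ℕ → Set
IsSatₑ n G = IsMinimum λ m →
  Σ[ H ∈ EdgeOrderedGraph n ] Saturated G H × ∣E∣ H ≡ m

-- f(n) = Ω(n √(log n)), for a function f given by its graph (F n s means
-- f(n) = s).  Squaring f(n) ≥ c n √(log n) and putting C = 1/c² gives
-- n² log n ≤ C f(n)²; the base of the logarithm and its rounding down only
-- change C, as log₂ n ≤ 2 ⌊log₂ n⌋ for n ≥ 1.
Ω[n√logn] : (ℕ → ℕ → Set) → Set
Ω[n√logn] F =
  ∃[ C ] C > 0 × (∃[ n₀ ] ∀ n → n ≥ n₀ → ∀ s → F n s →
    n * n * ⌊log₂ n ⌋ ≤ C * (s * s))

{-# OPTIONS --safe #-}
-- Inserting a missing edge xy of a semisaturated graph H at the end of the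
-- edge order where ab sits forces ab to be mapped to xy, so x and y have two
-- common neighbours that they rank oppositely.  Fix D and colour the vertices
-- with D colours; let a vertex x of degree < D survive if every neighbour v of
-- x has as its colour the rank of v in the edge order around x.  Two survivors
-- rank their common neighbours alike, so the survivors form a clique, and there
-- are at most D of them.  A vertex of degree δ survives a random colouring
-- with probability D ^ (- δ), so there are at most D ^ D vertices of degree
-- < D.  If D ^ D ≤ n / 2, half of the vertices have degree ≥ D, and such a D
-- can be chosen of order √(log n).
module Submission where

open import Algebra.Properties.CommutativeMonoid.Sum as Sum using ()
open import Algebra.Properties.Semiring.Sum as SemiringSum using ()
open import Data.Bool using (Bool; true; false; T; _∧_; _∨_; if_then_else_)
open import Data.Bool.Properties using (T?; T-∧; T-∨)
open import Data.Empty using (⊥-elim)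
open import Data.Fin as Fin using (Fin; zero; suc; toℕ)
open import Data.Fin.Properties as Fin using (any?; toℕ-fromℕ<)
open import Data.List using (List; _++_; length; filter; cartesianProduct; tabulate; map)
open import Data.List.Properties using (length-++; filter-++; map-tabulate)
open import Data.Nat using (ℕ; zero; suc; _+_; _*_; _^_; _∸_; _≤_; _<_; _>_; _≥_; _<ᵇ_; _<?_; z≤n; s≤s; z<s; ⌊_/2⌋; ⌈_/2⌉)
open import Data.Nat.DivMod using (_mod_; _%_; m<n⇒m%n≡m)
open import Data.Nat.Logarithm using (⌊log₂_⌋; ⌊log₂⌋-mono-≤; ⌊log₂⌊n/2⌋⌋≡⌊log₂n⌋∸1)
open import Data.Nat.Properties
open import Data.Nat.Tactic.RingSolver using (solve-∀)
open import Data.Product using (Σ-syntax; ∃-syntax; _×_; _,_; proj₁; proj₂)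
open import Data.Sum using (_⊎_; inj₁; inj₂)
open import Function using (_∘_; id; mk⇔)
open import Function.Bundles using (Equivalence)
open import Level using (0ℓ)
open import Relation.Binary.Definitions using (tri<; tri≈; tri>)
open import Relation.Binary.PropositionalEquality
open import Relation.Nullary using (¬_; Dec; yes; no; does)
open import Relation.Nullary.Decidable using (_×-dec_; _⊎-dec_; does-⇔; dec-true; dec-false)
open import Relation.Unary using (Pred; Decidable; _∈_; _∩_)
open import Defs

open Sum +-0-commutativeMonoid using (sum; sum-syntax; ∑-comm; ∑-distrib-+; sum-cong-≗; sum-replicate-zero)
open Sum *-1-commutativeMonoid using () renaming (sum to product)
open SemiringSum +-*-semiring using (*-distribˡ-sum; *-distribʳ-sum)

-- Indicators, sums, products and averaging over finite types.

𝟙 : Bool → ℕ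
𝟙 true  = 1
𝟙 false = 0

𝟙≤ : ∀ {b m} → (T b → 1 ≤ m) → 𝟙 b ≤ m
𝟙≤ {true}  f = f _
𝟙≤ {false} _ = z≤n

T⇒1≤𝟙 : ∀ {b} → T b → 1 ≤ 𝟙 b
T⇒1≤𝟙 {true} _ = ≤-refl

𝟙-mono : ∀ {b c} → (T b → T c) → 𝟙 b ≤ 𝟙 c
𝟙-mono f = 𝟙≤ (T⇒1≤𝟙 ∘ f)

𝟙-strict : ∀ {b c} → ¬ T b → T c → 𝟙 b < 𝟙 c
𝟙-strict {false} {true}  _  _ = ≤-refl
𝟙-strict {true}          ¬t _ = ⊥-elim (¬t _)

sum-mono-≤ : ∀ {n} {f g : Fin n → ℕ} → (∀ i → f i ≤ g i) → sum f ≤ sum g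
sum-mono-≤ {zero}  _   = z≤n
sum-mono-≤ {suc n} f≤g = +-mono-≤ (f≤g zero) (sum-mono-≤ (f≤g ∘ suc))

sum-mono-< : ∀ {n} {f g : Fin n → ℕ} → (∀ i → f i ≤ g i) → ∀ j → f j < g j → sum f < sum g
sum-mono-< f≤g zero    fⱼ<gⱼ = +-mono-<-≤ fⱼ<gⱼ (sum-mono-≤ (f≤g ∘ suc))
sum-mono-< f≤g (suc j) fⱼ<gⱼ = +-mono-≤-< (f≤g zero) (sum-mono-< (f≤g ∘ suc) j fⱼ<gⱼ)

sum-const : ∀ n m → ∑[ i < n ] m ≡ n * m
sum-const zero    m = refl
sum-const (suc n) m = cong (m +_) (sum-const n m)

sum-≟ : ∀ {n} (j : Fin n) → ∑[ i < n ] 𝟙 (does (i Fin.≟ j)) ≡ 1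
sum-≟ {suc n} zero    = cong suc (sum-replicate-zero n)
sum-≟         (suc j) = sum-≟ j

term≤sum : ∀ {n} (f : Fin n → ℕ) i → f i ≤ sum f
term≤sum f zero    = m≤m+n _ _
term≤sum f (suc i) = m≤n⇒m≤o+n (f zero) (term≤sum (f ∘ suc) i)

-- Averaging: if every term were below `A`, the sum would be below `suc n * A`. It supplies the next
-- colour in `good-colouring`.
large-term : ∀ {n} (f : Fin (suc n) → ℕ) A → suc n * A ≤ sum f → ∃[ i ] A ≤ f i
large-term {n} f A nA≤ with any? (λ i → A ≤? f i)
... | yes found = found
... | no  none  = ⊥-elim (<⇒≱ sum<nA nA≤)
  where
  f<A : ∀ i → f i < A
  f<A i = ≰⇒> (λ A≤ → none (i , A≤))
  sum<nA : sum f < suc n * A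
  sum<nA = subst (sum f <_) (sum-const (suc n) A) (sum-mono-< (<⇒≤ ∘ f<A) zero (f<A zero))

product-^ : ∀ {n} D (f e : Fin n → ℕ) → (∀ i → f i ≤ D ^ e i) → product f ≤ D ^ sum e
product-^ {zero}  D f e f≤ = ≤-refl
product-^ {suc n} D f e f≤ = begin
  f zero * product (f ∘ suc)          ≤⟨ *-mono-≤ (f≤ zero) (product-^ D (f ∘ suc) (e ∘ suc) (f≤ ∘ suc)) ⟩
  D ^ e zero * D ^ sum (e ∘ suc)      ≡⟨ ^-distribˡ-+-* D (e zero) _ ⟨
  D ^ (e zero + sum (e ∘ suc))        ∎
  where open ≤-Reasoning

m*n>0⇒m>0 : ∀ m {n} → 0 < m * n → 0 < m
m*n>0⇒m>0 (suc m) _ = z<s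

m*n>0⇒n>0 : ∀ m {n} → 0 < m * n → 0 < n
m*n>0⇒n>0 m {n} mn>0 = m*n>0⇒m>0 n (subst (0 <_) (*-comm m n) mn>0)

product>0 : ∀ {n} (f : Fin n → ℕ) → 0 < product f → ∀ i → 0 < f i
product>0 f ∏>0 zero    = m*n>0⇒m>0 (f zero) ∏>0
product>0 f ∏>0 (suc i) = product>0 (f ∘ suc) (m*n>0⇒n>0 (f zero) ∏>0) i

-- The method of conditional expectations: the colours are fixed one vertex at
-- a time, never letting the total weight drop below its average.
good-colouring : ∀ {m d} n (F : Fin m → Fin n → Fin (suc d) → ℕ) →
                 (∀ x v → suc d ≤ sum (F x v)) → (weight : Fin m → ℕ) →
                 Σ[ c ∈ (Fin n → Fin (suc d)) ] sum weight ≤ ∑[ x < m ] (weight x * product (λ v → F x v (c v)))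
good-colouring zero F avg weight =
  (λ ()) , sum-mono-≤ (λ x → ≤-reflexive (sym (*-identityʳ (weight x))))
good-colouring {m} {d} (suc n) F avg weight with large-term (λ q → ∑[ x < m ] (weight x * F x zero q)) (sum weight) total
  where
  open ≤-Reasoning
  total : suc d * sum weight ≤ ∑[ q < suc d ] ∑[ x < m ] (weight x * F x zero q)
  total = begin
    suc d * sum weight                                 ≡⟨ *-comm (suc d) (sum weight) ⟩
    sum weight * suc d                                 ≡⟨ *-distribʳ-sum (suc d) weight ⟩
    ∑[ x < m ] (weight x * suc d)                      ≤⟨ sum-mono-≤ (λ x → *-monoʳ-≤ (weight x) (avg x zero)) ⟩
    ∑[ x < m ] (weight x * sum (F x zero))             ≡⟨ sum-cong-≗ (λ x → *-distribˡ-sum (weight x) (F x zero)) ⟩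
    ∑[ x < m ] ∑[ q < suc d ] (weight x * F x zero q)  ≡⟨ ∑-comm (λ x q → weight x * F x zero q) ⟩
    ∑[ q < suc d ] ∑[ x < m ] (weight x * F x zero q)  ∎
-- The factor of the vertex just coloured is absorbed into the weights, which leaves the same
-- problem for the other vertices.
... | q , w≤w′ with good-colouring n (λ x v → F x (suc v)) (λ x v → avg x (suc v)) (λ x → weight x * F x zero q)
... | c , w′≤ = (λ { zero → q ; (suc v) → c v }) ,
  ≤-trans w≤w′ (≤-trans w′≤ (sum-mono-≤ (λ x → ≤-reflexive (*-assoc (weight x) _ _))))

-- The edge list counted by a double sum.

length-filter-tabulate : ∀ {A : Set} {P : Pred A 0ℓ} (P? : Decidable P) {n} (f : Fin n → A) →
                         length (filter P? (tabulate f)) ≡ ∑[ i < n ] 𝟙 (does (P? (f i)))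
length-filter-tabulate P? {zero}  f = refl
length-filter-tabulate P? {suc n} f with does (P? (f zero))
... | true  = cong suc (length-filter-tabulate P? (f ∘ suc))
... | false = length-filter-tabulate P? (f ∘ suc)

length-filter-cartesianProduct : ∀ {A B : Set} {P : Pred (A × B) 0ℓ} (P? : Decidable P) {m n} (f : Fin m → A) (g : Fin n → B) →
  length (filter P? (cartesianProduct (tabulate f) (tabulate g))) ≡ ∑[ i < m ] ∑[ j < n ] 𝟙 (does (P? (f i , g j)))
length-filter-cartesianProduct P? {zero}  f g = refl
length-filter-cartesianProduct {A} {B} P? {suc m} f g = begin
  length (filter P? (map (f zero ,_) (tabulate g) ++ rest))                  ≡⟨ cong length (filter-++ P? (map (f zero ,_) (tabulate g)) rest) ⟩
  length (filter P? (map (f zero ,_) (tabulate g)) ++ filter P? rest)        ≡⟨ length-++ (filter P? (map (f zero ,_) (tabulate g))) ⟩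
  length (filter P? (map (f zero ,_) (tabulate g))) + length (filter P? rest)
    ≡⟨ cong₂ _+_ (trans (cong (length ∘ filter P?) (map-tabulate g (f zero ,_))) (length-filter-tabulate P? (λ j → f zero , g j)))
                 (length-filter-cartesianProduct P? (f ∘ suc) g) ⟩
  _ ∎
  where
  open ≡-Reasoning
  rest : List (A × B)
  rest = cartesianProduct (tabulate (f ∘ suc)) (tabulate g)

-- Degrees, ranks and the colouring argument.

module _ {n} (H : EdgeOrderedGraph n) where
  open EdgeOrderedGraph H

  Adj-sym : ∀ {u v} → Adj u v → Adj v u
  Adj-sym {u} {v} = subst T (adj-sym u v)

  Adj-irrefl : ∀ {u v} → Adj u v → u ≢ v
  Adj-irrefl {u} uv refl = subst T (adj-irrefl u) uv

  deg : Fin n → ℕ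
  deg x = ∑[ v < n ] 𝟙 (adj x v)

  -- `edges` lists each edge once, with its smaller end first, so an ordered adjacent pair is
  -- accounted for by `up i j` or by `up j i`; exchanging the sums turns both into `∣E∣`.
  sum-deg≤2∣E∣ : sum deg ≤ ∣E∣ + ∣E∣
  sum-deg≤2∣E∣ = begin
    ∑[ i < n ] ∑[ j < n ] 𝟙 (adj i j)                            ≤⟨ sum-mono-≤ (λ i → sum-mono-≤ (split i)) ⟩
    ∑[ i < n ] ∑[ j < n ] (up i j + up j i)                      ≡⟨ sum-cong-≗ (λ i → ∑-distrib-+ (up i) (λ j → up j i)) ⟩
    ∑[ i < n ] (∑[ j < n ] up i j + ∑[ j < n ] up j i)           ≡⟨ ∑-distrib-+ (λ i → ∑[ j < n ] up i j) _ ⟩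
    ∑[ i < n ] ∑[ j < n ] up i j + ∑[ i < n ] ∑[ j < n ] up j i  ≡⟨ cong (∑[ i < n ] ∑[ j < n ] up i j +_) (∑-comm (λ i j → up j i)) ⟩
    ∑[ i < n ] ∑[ j < n ] up i j + ∑[ i < n ] ∑[ j < n ] up i j  ≡⟨ cong₂ _+_ count count ⟨
    ∣E∣ + ∣E∣                                                    ∎
    where
    open ≤-Reasoning
    up? : ∀ i j → Dec (i Fin.< j × Adj i j)
    up? i j = (i Fin.<? j) ×-dec T? (adj i j)
    up : Fin n → Fin n → ℕ
    up i j = 𝟙 (does (up? i j))
    up≡1 : ∀ {i j} → i Fin.< j → Adj i j → up i j ≡ 1
    up≡1 {i} {j} i<j ij = cong 𝟙 (dec-true (up? i j) (i<j , ij))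
    count : ∣E∣ ≡ ∑[ i < n ] ∑[ j < n ] up i j
    count = length-filter-cartesianProduct (λ (i , j) → up? i j) id id
    bound : ∀ i j → Adj i j → 1 ≤ up i j + up j i
    bound i j ij with Fin.<-cmp i j
    ... | tri< i<j _ _  = ≤-trans (≤-reflexive (sym (up≡1 i<j ij))) (m≤m+n _ _)
    ... | tri≈ _ i≡j _  = ⊥-elim (Adj-irrefl ij i≡j)
    ... | tri> _ _ j<i  = ≤-trans (≤-reflexive (sym (up≡1 j<i (Adj-sym ij)))) (m≤n+m _ _)
    split : ∀ i j → 𝟙 (adj i j) ≤ up i j + up j i
    split i j = 𝟙≤ (bound i j)

  -- Positions replace labels so that the values at the neighbours of `x` lie below `deg x` and can
  -- serve as colours.
  rank : Fin n → Fin n → ℕ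
  rank x v = ∑[ u < n ] 𝟙 (adj x u ∧ (label x u <ᵇ label x v))

  private
    not-before-itself : ∀ {x v} → ¬ T (adj x v ∧ (label x v <ᵇ label x v))
    not-before-itself {x} {v} t = <-irrefl refl (<ᵇ⇒< (label x v) _ (proj₂ (Equivalence.to (T-∧ {adj x v}) t)))

  rank-mono-< : ∀ {x v w} → Adj x v → label x v < label x w → rank x v < rank x w
  -- The strict gain comes from `v`, which precedes `w` but not itself.
  rank-mono-< {x} {v} {w} xv v<w = sum-mono-< (λ u → 𝟙-mono (earlier u)) v (𝟙-strict (not-before-itself {x}) before)
    where
    open Equivalence
    earlier : ∀ u → T (adj x u ∧ (label x u <ᵇ label x v)) → T (adj x u ∧ (label x u <ᵇ label x w))
    earlier u t = let (xu , u<v) = to T-∧ t in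
      from T-∧ (xu , <⇒<ᵇ (<-trans (<ᵇ⇒< _ _ u<v) v<w))
    before : T (adj x v ∧ (label x v <ᵇ label x w))
    before = from T-∧ (xv , <⇒<ᵇ v<w)

  rank<deg : ∀ {x v} → Adj x v → rank x v < deg x
  rank<deg {x} {v} xv = sum-mono-< (λ u → 𝟙-mono (proj₁ ∘ Equivalence.to (T-∧ {adj x u}))) v (𝟙-strict (not-before-itself {x}) xv)

  Reversed : Fin n → Fin n → Set
  Reversed x y = ∃[ v ] ∃[ w ] (Adj x v × Adj x w) × (Adj y v × Adj y w) ×
                 label x v < label x w × label y w < label y v

  Reversed-sym : ∀ {x y} → Reversed x y → Reversed y x
  Reversed-sym (v , w , (xv , xw) , (yv , yw) , <ˣ , <ʸ) = w , v , (yw , yv) , (xw , xv) , <ʸ , <ˣ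

  module _ (reversed : ∀ x y → x ≢ y → ¬ Adj x y → Reversed x y) (d : ℕ) where
    private
      D : ℕ
      D = suc d

    low : Fin n → ℕ
    low x = 𝟙 (deg x <ᵇ D)

    private
      -- For deg x < D the reduction mod D does nothing.
      colour : Fin n → Fin n → Fin D
      colour x v = rank x v mod D

      -- The event that `v` has the colour wanted by `x`, divided by its probability `1 / D`; for a
      -- non-neighbour there is no condition. Either way the mean over the colours is 1.
      fit : Fin n → Fin n → Fin D → ℕ
      fit x v q = if adj x v then 𝟙 (does (q Fin.≟ colour x v)) * D else 1

      fit-average : ∀ x v → D ≤ sum (fit x v)
      fit-average x v with adj x v
      ... | true  = ≤-reflexive (begin
        D                                                     ≡⟨ *-identityˡ D ⟨
        1 * D                                                 ≡⟨ cong (_* D) (sum-≟ (colour x v)) ⟨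
        (∑[ q < D ] 𝟙 (does (q Fin.≟ colour x v))) * D        ≡⟨ *-distribʳ-sum D (λ q → 𝟙 (does (q Fin.≟ colour x v))) ⟩
        ∑[ q < D ] (𝟙 (does (q Fin.≟ colour x v)) * D)        ∎)
        where open ≡-Reasoning
      ... | false = ≤-reflexive (sym (trans (sum-const D 1) (*-identityʳ D)))

      fit≤ : ∀ x v q → fit x v q ≤ D ^ 𝟙 (adj x v)
      fit≤ x v q with adj x v | does (q Fin.≟ colour x v)
      ... | true  | true  = ≤-reflexive (*-comm 1 D)
      ... | true  | false = z≤n
      ... | false | _     = ≤-refl

      fit>0⇒colour : ∀ {x v q} → Adj x v → 0 < fit x v q → q ≡ colour x v
      fit>0⇒colour {x} {v} {q} xv 0<f with adj x v | q Fin.≟ colour x v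
      ... | true | yes q≡ = q≡

    module _ (c : Fin n → Fin D) where
      private
        -- This is `D ^ deg x` if `x` has low degree and survives the colouring `c`, and 0
        -- otherwise.
        score : Fin n → ℕ
        score x = low x * product (λ v → fit x v (c v))

        score>0⇒low : ∀ {x} → 0 < score x → deg x < D
        score>0⇒low {x} s with deg x <ᵇ D in eq
        ... | true = <ᵇ⇒< _ _ (subst T (sym eq) _)

        score>0⇒rank : ∀ {x v} → 0 < score x → Adj x v → toℕ (c v) ≡ rank x v
        score>0⇒rank {x} {v} s xv = begin
          toℕ (c v)        ≡⟨ cong toℕ (fit>0⇒colour xv (product>0 (λ v → fit x v (c v)) (m*n>0⇒n>0 (low x) s) v)) ⟩
          toℕ (colour x v) ≡⟨ toℕ-fromℕ< _ ⟩
          rank x v % D     ≡⟨ m<n⇒m%n≡m (<-trans (rank<deg xv) (score>0⇒low s)) ⟩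
          rank x v         ∎
          where open ≡-Reasoning

        -- Both survivors read the rank of a common neighbour off the same colour, so they order
        -- their common neighbours alike, whereas a missing edge would make two of them reversed.
        survivors-adjacent : ∀ {x y} → 0 < score x → 0 < score y → x ≢ y → Adj x y
        survivors-adjacent {x} {y} sx sy x≢y with T? (adj x y)
        ... | yes xy = xy
        ... | no ¬xy = let (v , w , (xv , xw) , (yv , yw) , <ˣ , <ʸ) = reversed x y x≢y ¬xy in
          ⊥-elim (<-asym
            (subst₂ _<_ (sym (score>0⇒rank sx xv)) (sym (score>0⇒rank sx xw)) (rank-mono-< xv <ˣ))
            (subst₂ _<_ (sym (score>0⇒rank sy yw)) (sym (score>0⇒rank sy yv)) (rank-mono-< yw <ʸ)))

        -- The exponent is `d` rather than `D`, so that at most `D` survivors contribute at most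
        -- `D ^ D` together.
        score≤ : ∀ x → score x ≤ D ^ d
        score≤ x with 0 <? score x
        ... | no ¬s = ≤-trans (≮⇒≥ ¬s) z≤n
        ... | yes s = begin
          low x * product (λ v → fit x v (c v)) ≤⟨ *-mono-≤ (𝟙≤ {deg x <ᵇ D} (λ _ → ≤-refl))
                                                              (product-^ D _ (𝟙 ∘ adj x) (λ v → fit≤ x v (c v))) ⟩
          1 * D ^ deg x                         ≡⟨ *-identityˡ _ ⟩
          D ^ deg x                             ≤⟨ ^-monoʳ-≤ D (≤-pred (score>0⇒low s)) ⟩
          D ^ d                                 ∎
          where open ≤-Reasoning

      -- All survivors lie in the closed neighbourhood of any one survivor `y`, which has
      -- `suc (deg y) ≤ D` elements.
      total-score≤ : sum score ≤ D ^ D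
      total-score≤ with any? (λ y → 0 <? score y)
      ... | no none = begin
        sum score       ≤⟨ sum-mono-≤ (λ x → ≮⇒≥ (λ s → none (x , s))) ⟩
        ∑[ x < n ] 0    ≡⟨ sum-replicate-zero n ⟩
        0               ≤⟨ z≤n ⟩
        D ^ D           ∎
        where open ≤-Reasoning
      ... | yes (y , sy) = begin
        sum score                                                      ≤⟨ sum-mono-≤ near ⟩
        ∑[ x < n ] ((𝟙 (does (x Fin.≟ y)) + 𝟙 (adj y x)) * D ^ d)      ≡⟨ *-distribʳ-sum (D ^ d) (λ x → 𝟙 (does (x Fin.≟ y)) + 𝟙 (adj y x)) ⟨
        (∑[ x < n ] (𝟙 (does (x Fin.≟ y)) + 𝟙 (adj y x))) * D ^ d      ≡⟨ cong (_* D ^ d) (∑-distrib-+ (λ x → 𝟙 (does (x Fin.≟ y))) (𝟙 ∘ adj y)) ⟩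
        (∑[ x < n ] 𝟙 (does (x Fin.≟ y)) + deg y) * D ^ d              ≡⟨ cong (λ e → (e + deg y) * D ^ d) (sum-≟ y) ⟩
        suc (deg y) * D ^ d                                            ≤⟨ *-monoˡ-≤ (D ^ d) (score>0⇒low sy) ⟩
        D * D ^ d                                                      ∎
        where
        open ≤-Reasoning
        near : ∀ x → score x ≤ (𝟙 (does (x Fin.≟ y)) + 𝟙 (adj y x)) * D ^ d
        near x with 0 <? score x
        ... | no ¬s = ≤-trans (≮⇒≥ ¬s) z≤n
        ... | yes s = ≤-trans (score≤ x) (≤-trans (≤-reflexive (sym (*-identityˡ _))) (*-monoˡ-≤ (D ^ d) covered))
          where
          covered : 1 ≤ 𝟙 (does (x Fin.≟ y)) + 𝟙 (adj y x)
          covered with x Fin.≟ y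
          ... | yes _   = s≤s z≤n
          ... | no x≢y = T⇒1≤𝟙 (survivors-adjacent sy s (x≢y ∘ sym))

    -- With `low` as initial weight, some colouring has a total score at least the number of low
    -- vertices, while no colouring exceeds `D ^ D`.
    few-low : sum low ≤ D ^ D
    few-low = let (c , low≤score) = good-colouring n fit fit-average low in
      ≤-trans low≤score (total-score≤ c)

    many-edges : 2 * D ^ D ≤ n → D * n ≤ 4 * ∣E∣
    -- The degree count is doubled so that the share of the low vertices, `D * (2 * D ^ D)`, is paid
    -- for by one of the two copies of `D * n`.
    many-edges 2Dᴰ≤n = +-cancelˡ-≤ (D * n) _ _ (begin
      D * n + D * n                          ≤⟨ +-mono-≤ Dn≤ Dn≤ ⟩
      (D * D ^ D + (∣E∣ + ∣E∣)) + (D * D ^ D + (∣E∣ + ∣E∣)) ≡⟨ rearrange D (D ^ D) ∣E∣ ⟩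
      D * (2 * D ^ D) + 4 * ∣E∣              ≤⟨ +-monoˡ-≤ (4 * ∣E∣) (*-monoʳ-≤ D 2Dᴰ≤n) ⟩
      D * n + 4 * ∣E∣                        ∎)
      where
      open ≤-Reasoning
      rearrange : ∀ a b e → (a * b + (e + e)) + (a * b + (e + e)) ≡ a * (2 * b) + 4 * e
      rearrange = solve-∀
      D≤ : ∀ x → D ≤ D * low x + deg x
      D≤ x with deg x <ᵇ D in eq
      ... | true  = ≤-trans (≤-reflexive (sym (*-identityʳ D))) (m≤m+n _ _)
      ... | false = ≤-trans (≮⇒≥ (subst T eq ∘ <⇒<ᵇ {deg x} {D})) (m≤n+m _ _)
      Dn≤ : D * n ≤ D * D ^ D + (∣E∣ + ∣E∣)
      Dn≤ = begin
        D * n                               ≡⟨ *-comm D n ⟩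
        n * D                               ≡⟨ sum-const n D ⟨
        ∑[ x < n ] D                        ≤⟨ sum-mono-≤ D≤ ⟩
        ∑[ x < n ] (D * low x + deg x)      ≡⟨ ∑-distrib-+ (λ x → D * low x) deg ⟩
        ∑[ x < n ] (D * low x) + sum deg    ≡⟨ cong (_+ sum deg) (*-distribˡ-sum D low) ⟨
        D * sum low + sum deg               ≤⟨ +-mono-≤ (*-monoʳ-≤ D few-low) sum-deg≤2∣E∣ ⟩
        D * D ^ D + (∣E∣ + ∣E∣)             ∎

-- Logarithms, integer square roots and the choice of `D`.

n<2^n : ∀ n → n < 2 ^ n
n<2^n zero    = z<s
n<2^n (suc n) = begin-strict
  suc n            ≤⟨ n<2^n n ⟩
  2 ^ n            <⟨ m<m+n (2 ^ n) (≤-trans (m^n>0 2 n) (m≤m+n _ 0)) ⟩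
  2 ^ suc n        ∎
  where open ≤-Reasoning

sqrt-exists : ∀ m → ∃[ r ] r * r ≤ m × m < suc r * suc r
sqrt-exists zero = 0 , z≤n , z<s
sqrt-exists (suc m) with sqrt-exists m
... | r , r²≤m , m<r+1² with suc r * suc r ≤? suc m
... | yes ≤m = suc r , ≤m , ≤-<-trans m<r+1² (*-mono-< (n<1+n (suc r)) (n<1+n (suc r)))
... | no  ≰m = r , m≤n⇒m≤1+n r²≤m , ≰⇒> ≰m

-- Halving `n` lowers both the exponent and the logarithm by one.
n<2^k⇒⌊log₂n⌋<k : ∀ k n → n < 2 ^ suc k → ⌊log₂ n ⌋ < suc k
n<2^k⇒⌊log₂n⌋<k zero    0 _ = z<s
n<2^k⇒⌊log₂n⌋<k zero    1 _ = z<s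
n<2^k⇒⌊log₂n⌋<k zero    (suc (suc n)) (s≤s (s≤s ()))
n<2^k⇒⌊log₂n⌋<k (suc k) n n< = s≤s (begin
  ⌊log₂ n ⌋                ≤⟨ m≤n+m∸n _ 1 ⟩
  suc (⌊log₂ n ⌋ ∸ 1)      ≡⟨ cong suc (⌊log₂⌊n/2⌋⌋≡⌊log₂n⌋∸1 n) ⟨
  suc ⌊log₂ ⌊ n /2⌋ ⌋      ≤⟨ n<2^k⇒⌊log₂n⌋<k k ⌊ n /2⌋ half< ⟩
  suc k                    ∎)
  where
  open ≤-Reasoning
  half< : ⌊ n /2⌋ < 2 ^ suc k
  half< = *-cancelˡ-< 2 _ _ (begin-strict
    2 * ⌊ n /2⌋             ≤⟨ +-monoʳ-≤ ⌊ n /2⌋ (≤-trans (≤-reflexive (+-identityʳ _)) (⌊n/2⌋≤⌈n/2⌉ n)) ⟩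
    ⌊ n /2⌋ + ⌈ n /2⌉       ≡⟨ ⌊n/2⌋+⌈n/2⌉≡n n ⟩
    n                       <⟨ n< ⟩
    2 ^ suc (suc k)         ∎)

-- The logarithm is taken positive because `⌊log₂ 0 ⌋` is 0, and `2 ^ 0 ≤ 0` fails.
suc-k≡⌊log₂n⌋⇒2^suc-k≤n : ∀ k n → suc k ≡ ⌊log₂ n ⌋ → 2 ^ suc k ≤ n
suc-k≡⌊log₂n⌋⇒2^suc-k≤n k n eq = ≮⇒≥ (λ n< → <-irrefl (sym eq) (n<2^k⇒⌊log₂n⌋<k k n n<))

-- The number of colours is the integer square root of ⌊log₂ n⌋ - 1.
edge-bound : ∀ {n} (H : EdgeOrderedGraph n) → let open EdgeOrderedGraph H in
             (∀ x y → x ≢ y → ¬ Adj x y → Reversed H x y) → n ≥ 4 →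
             n * n * ⌊log₂ n ⌋ ≤ 64 * (∣E∣ * ∣E∣)
edge-bound {n} H reversed n≥4 with ⌊log₂ n ⌋ in eq | ⌊log₂⌋-mono-≤ n≥4
... | suc m | s≤s 1≤m with sqrt-exists m
-- `n ≥ 4` makes the logarithm `suc m` at least 2, so the root of `m` is not zero.
... | zero  , _ , m<1 = ⊥-elim (<⇒≱ m<1 1≤m)
... | D@(suc d) , D²≤m , m<[1+D]² = begin
  -- Maximality of the root gives `suc m ≤ suc D * suc D`, and `suc D ≤ D + D` since `D` is
  -- positive. The constant 64 is 4 from this doubling times 16 from `Dn≤4E`.
  n * n * suc m                              ≤⟨ *-monoʳ-≤ (n * n) (≤-trans m<[1+D]² (*-mono-≤ 1+D≤2D 1+D≤2D)) ⟩
  n * n * ((D + D) * (D + D))                ≡⟨ lhs n D ⟩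
  4 * ((D * n) * (D * n))                    ≤⟨ *-monoʳ-≤ 4 (*-mono-≤ Dn≤4E Dn≤4E) ⟩
  4 * ((4 * ∣E∣) * (4 * ∣E∣))                ≡⟨ rhs ∣E∣ ⟩
  64 * (∣E∣ * ∣E∣)                           ∎
  where
  open ≤-Reasoning
  open EdgeOrderedGraph H using (∣E∣)
  lhs : ∀ a b → a * a * ((b + b) * (b + b)) ≡ 4 * ((b * a) * (b * a))
  lhs = solve-∀
  rhs : ∀ e → 4 * ((4 * e) * (4 * e)) ≡ 64 * (e * e)
  rhs = solve-∀
  1+D≤2D : suc D ≤ D + D
  1+D≤2D = +-monoˡ-≤ D (s≤s z≤n)
  2Dᴰ≤n : 2 * D ^ D ≤ n
  2Dᴰ≤n = begin
    -- The factor 2 uses up the 1 that was taken off the logarithm before extracting the root.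
    2 * D ^ D          ≤⟨ *-monoʳ-≤ 2 (^-monoˡ-≤ D (<⇒≤ (n<2^n D))) ⟩
    2 * (2 ^ D) ^ D    ≡⟨ cong (2 *_) (^-*-assoc 2 D D) ⟩
    2 ^ suc (D * D)    ≤⟨ ^-monoʳ-≤ 2 (s≤s D²≤m) ⟩
    2 ^ suc m          ≤⟨ suc-k≡⌊log₂n⌋⇒2^suc-k≤n m n (sym eq) ⟩
    n                  ∎
  Dn≤4E : D * n ≤ 4 * ∣E∣
  Dn≤4E = many-edges H reversed d 2Dᴰ≤n

-- Inserting an edge into an edge-ordered graph.

SameEdge-flip : ∀ {n} {u v x y : Fin n} → SameEdge u v x y → SameEdge v u x y
SameEdge-flip (inj₁ (p , q)) = inj₂ (q , p)
SameEdge-flip (inj₂ (p , q)) = inj₁ (q , p)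

SameEdge-sym : ∀ {n} {u v x y : Fin n} → SameEdge u v x y → SameEdge x y u v
SameEdge-sym (inj₁ (p , q)) = inj₁ (sym p , sym q)
SameEdge-sym (inj₂ (p , q)) = inj₂ (sym q , sym p)

SameEdge-trans : ∀ {n} {u v x y z w : Fin n} → SameEdge u v x y → SameEdge x y z w → SameEdge u v z w
SameEdge-trans (inj₁ (refl , refl)) same = same
SameEdge-trans (inj₂ (refl , refl)) same = SameEdge-flip same

SameEdge-map : ∀ {m n} (f : Fin m → Fin n) {u v x y} → SameEdge u v x y → SameEdge (f u) (f v) (f x) (f y)
SameEdge-map f (inj₁ (p , q)) = inj₁ (cong f p , cong f q)
SameEdge-map f (inj₂ (p , q)) = inj₂ (cong f p , cong f q)

-- Abstract so that does (sameEdge? u v x y) stays intact for with-abstraction.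
abstract
  sameEdge? : ∀ {n} (u v x y : Fin n) → Dec (SameEdge u v x y)
  sameEdge? u v x y = (u Fin.≟ x ×-dec v Fin.≟ y) ⊎-dec (u Fin.≟ y ×-dec v Fin.≟ x)

-- The edge xy is inserted with label t, the old labels being shifted by one so
-- that t = 0 puts it first.
module Insertion {n} (H : EdgeOrderedGraph n) {x y : Fin n} (x≢y : x ≢ y)
                 (¬xy : ¬ EdgeOrderedGraph.Adj H x y) (t : ℕ)
                 (fresh : ∀ u v → t ≢ suc (EdgeOrderedGraph.label H u v)) where
  open EdgeOrderedGraph H

  private
    new : Fin n → Fin n → Bool
    new u v = does (sameEdge? u v x y)

    new-sym : ∀ u v → new u v ≡ new v u
    new-sym u v = does-⇔ (mk⇔ SameEdge-flip SameEdge-flip) (sameEdge? u v x y) (sameEdge? v u x y)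

    adj⁺ : Fin n → Fin n → Bool
    adj⁺ u v = new u v ∨ adj u v

    label⁺ : Fin n → Fin n → ℕ
    label⁺ u v = if new u v then t else suc (label u v)

    new-loop : ∀ u → ¬ SameEdge u u x y
    new-loop u (inj₁ (p , q)) = x≢y (trans (sym p) q)
    new-loop u (inj₂ (p , q)) = x≢y (trans (sym q) p)

    label⁺-injective : ∀ {u v u′ v′} → T (adj⁺ u v) → T (adj⁺ u′ v′) →
                       label⁺ u v ≡ label⁺ u′ v′ → SameEdge u v u′ v′
    label⁺-injective {u} {v} {u′} {v′} uv u′v′ eq with sameEdge? u v x y | sameEdge? u′ v′ x y
    ... | yes s | yes s′ = SameEdge-trans s (SameEdge-sym s′)
    ... | yes _ | no _   = ⊥-elim (fresh u′ v′ eq)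
    ... | no _  | yes _  = ⊥-elim (fresh u v (sym eq))
    ... | no _  | no _   = label-injective uv u′v′ (suc-injective eq)

  H⁺ : EdgeOrderedGraph n
  H⁺ = record
    { adj             = adj⁺
    ; adj-sym         = λ u v → cong₂ _∨_ (new-sym u v) (adj-sym u v)
    ; adj-irrefl      = λ u → cong₂ _∨_ (dec-false (sameEdge? u u x y) (new-loop u)) (adj-irrefl u)
    ; label           = label⁺
    ; label-sym       = λ u v → cong₂ (λ b l → if b then t else suc l) (new-sym u v) (label-sym u v)
    ; label-injective = label⁺-injective
    }

  open EdgeOrderedGraph H⁺ using () renaming (Adj to Adj⁺)

  label⁺-new : ∀ {u v} → SameEdge u v x y → label⁺ u v ≡ t
  label⁺-new {u} {v} s = cong (λ b → if b then t else suc (label u v)) (dec-true (sameEdge? u v x y) s)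

  old-edge : ∀ {u v} → ¬ SameEdge u v x y → Adj⁺ u v → Adj u v × label⁺ u v ≡ suc (label u v)
  old-edge {u} {v} ¬s uv with sameEdge? u v x y
  ... | yes s = ⊥-elim (¬s s)
  ... | no _  = uv , refl

  old-edge⁻ : ∀ {u v} → Adj u v → ¬ SameEdge u v x y
  old-edge⁻ uv (inj₁ (refl , refl)) = ¬xy uv
  old-edge⁻ uv (inj₂ (refl , refl)) = ¬xy (Adj-sym H uv)

  label⁺-old : ∀ {u v} → Adj u v → label⁺ u v ≡ suc (label u v)
  label⁺-old uv = proj₂ (old-edge (old-edge⁻ uv) (Equivalence.from T-∨ (inj₂ uv)))

  isInsertion : IsInsertion H x y H⁺
  isInsertion = record
    { edges⁺ = λ u v → mk⇔ (to⁺ u v) (from⁺ u v)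
    ; order⁺ = λ uv u′v′ l<l′ → subst₂ _<_ (sym (label⁺-old uv)) (sym (label⁺-old u′v′)) (s≤s l<l′)
    }
    where
    to⁺ : ∀ u v → Adj⁺ u v → Adj u v ⊎ SameEdge u v x y
    to⁺ u v uv with sameEdge? u v x y
    ... | yes s = inj₂ s
    ... | no _  = inj₁ uv
    from⁺ : ∀ u v → Adj u v ⊎ SameEdge u v x y → Adj⁺ u v
    from⁺ u v (inj₁ uv) = Equivalence.from T-∨ (inj₂ uv)
    from⁺ u v (inj₂ s)  = Equivalence.from T-∨ (inj₁ (subst T (sym (dec-true (sameEdge? u v x y) s)) _))

-- From semisaturation to oppositely ranked common neighbours.

module _ {k n} (G : EdgeOrderedGraph k) (H : EdgeOrderedGraph n) where
  open EdgeOrderedGraph G renaming (label to l)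
  open EdgeOrderedGraph H using () renaming (label to L)

  -- Common to the minimal and the maximal case: `forced` and the injectivity of labels identify the
  -- edge of `G` lying on `xy` as `ab`. The four edges joining `a`, `b` to `v`, `w` then land on
  -- edges of `H` and keep their order.
  reversed-ends : ∀ {a b v w} → Adj a b → v ∈ N a ∩ N b → w ∈ N a ∩ N b → l a v < l a w → l b v > l b w →
    Semisaturated G H → ∀ {x y} (x≢y : x ≢ y) (¬xy : ¬ EdgeOrderedGraph.Adj H x y) t (fresh : ∀ u v → t ≢ suc (L u v)) →
    let open Insertion H x≢y ¬xy t fresh in
    (∀ (φ : Copy G H⁺) {c d} → Adj c d → SameEdge (Copy.map φ c) (Copy.map φ d) x y → l a b ≡ l c d) →
    Reversed H x y
  reversed-ends {a} {b} {v} {w} ab (av , bv) (aw , bw) <ᵃ >ᵇ semi {x} {y} x≢y ¬xy t fresh forced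
    with semi x y x≢y ¬xy (Insertion.H⁺ H x≢y ¬xy t fresh) (Insertion.isInsertion H x≢y ¬xy t fresh)
  ... | φ , c , d , cd , cd↦xy = conclude ab↦xy
    where
    open Insertion H x≢y ¬xy t fresh
    open Copy φ renaming (map to f)

    ab↦xy : SameEdge (f a) (f b) x y
    ab↦xy = SameEdge-trans (SameEdge-map f (label-injective ab cd (forced φ cd cd↦xy))) cd↦xy

    -- Otherwise `u` would share its image with `a` or `b`, although it is adjacent to both.
    old : ∀ {p u} → Adj a u → Adj b u → ¬ SameEdge (f p) (f u) x y
    old au bu s with SameEdge-trans s (SameEdge-sym ab↦xy)
    ... | inj₁ (_ , fu≡fb) = Adj-irrefl G bu (sym (map-injective fu≡fb))
    ... | inj₂ (_ , fu≡fa) = Adj-irrefl G au (sym (map-injective fu≡fa))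

    transfer : ∀ {p q r} → Adj p q → Adj p r → ¬ SameEdge (f p) (f q) x y → ¬ SameEdge (f p) (f r) x y →
               l p q < l p r → L (f p) (f q) < L (f p) (f r)
    -- `≤-pred` undoes the shift of the old labels by one.
    transfer pq pr ¬q ¬r q<r = ≤-pred (subst₂ _<_
      (proj₂ (old-edge ¬q (preserves-adj pq))) (proj₂ (old-edge ¬r (preserves-adj pr)))
      (preserves-order pq pr q<r))

    reversed : Reversed H (f a) (f b)
    reversed = f v , f w
      , (proj₁ (old-edge (old av bv) (preserves-adj av)) , proj₁ (old-edge (old aw bw) (preserves-adj aw)))
      , (proj₁ (old-edge (old av bv) (preserves-adj bv)) , proj₁ (old-edge (old aw bw) (preserves-adj bw)))
      , transfer av aw (old av bv) (old aw bw) <ᵃ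
      , transfer bw bv (old aw bw) (old av bv) >ᵇ

    conclude : SameEdge (f a) (f b) x y → Reversed H x y
    conclude (inj₁ (fa≡x , fb≡y)) = subst₂ (Reversed H) fa≡x fb≡y reversed
    conclude (inj₂ (fa≡y , fb≡x)) = subst₂ (Reversed H) fb≡x fa≡y (Reversed-sym H reversed)

  semisaturated⇒reversed : ∀ {a b v w} → IsMinimalEdge a b ⊎ IsMaximalEdge a b →
    v ∈ N a ∩ N b → w ∈ N a ∩ N b → l a v < l a w → l b v > l b w →
    Semisaturated G H → ∀ x y → x ≢ y → ¬ EdgeOrderedGraph.Adj H x y → Reversed H x y
  semisaturated⇒reversed {a} {b} (inj₁ (ab , minimal)) v∈ w∈ <ᵃ >ᵇ semi x y x≢y ¬xy =
    reversed-ends ab v∈ w∈ <ᵃ >ᵇ semi x≢y ¬xy 0 (λ _ _ ()) forced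
    where
    open Insertion H x≢y ¬xy 0 (λ _ _ ())
    forced : ∀ (φ : Copy G H⁺) {c d} → Adj c d → SameEdge (Copy.map φ c) (Copy.map φ d) x y → l a b ≡ l c d
    -- If `ab` were strictly below `cd`, its image would need a label below 0, the label of `xy`.
    forced φ {c} {d} cd cd↦xy = ≤-antisym (minimal c d cd) (≮⇒≥ λ ab<cd →
      n≮0 (subst (_ <_) (label⁺-new cd↦xy) (Copy.preserves-order φ ab cd ab<cd)))
  semisaturated⇒reversed {a} {b} (inj₂ (ab , maximal)) v∈ w∈ <ᵃ >ᵇ semi x y x≢y ¬xy =
    reversed-ends ab v∈ w∈ <ᵃ >ᵇ semi x≢y ¬xy top fresh forced
    where
    M : ℕ
    M = ∑[ u < n ] ∑[ v < n ] L u v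
    L≤M : ∀ u v → L u v ≤ M
    L≤M u v = ≤-trans (term≤sum (L u) v) (term≤sum (λ u → sum (L u)) u)
    top : ℕ
    top = 2 + M
    fresh : ∀ u v → top ≢ suc (L u v)
    fresh u v eq = <⇒≱ (≤-reflexive (suc-injective eq)) (L≤M u v)
    open Insertion H x≢y ¬xy top fresh
    label⁺≤top : ∀ u v → EdgeOrderedGraph.label H⁺ u v ≤ top
    label⁺≤top u v with does (sameEdge? u v x y)
    ... | true  = ≤-refl
    ... | false = s≤s (m≤n⇒m≤1+n (L≤M u v))
    forced : ∀ (φ : Copy G H⁺) {c d} → Adj c d → SameEdge (Copy.map φ c) (Copy.map φ d) x y → l a b ≡ l c d
    forced φ {c} {d} cd cd↦xy = ≤-antisym
      (≮⇒≥ λ cd<ab → <⇒≱ (subst (_< _) (label⁺-new cd↦xy) (Copy.preserves-order φ cd ab cd<ab)) (label⁺≤top _ _))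
      (maximal c d cd)

corollary53 : ∀ {k : ℕ} (G : EdgeOrderedGraph k) → let open EdgeOrderedGraph G renaming (label to l) in
    (a b : Fin k) → IsMinimalEdge a b ⊎ IsMaximalEdge a b →
    (v w : Fin k) → v ∈ N a ∩ N b → w ∈ N a ∩ N b →
    l a v < l a w → l b v > l b w →
    (∀ n s t → IsSatₑ n G t → IsSsatₑ n G s → t ≥ s) × Ω[n√logn] (λ n s → IsSsatₑ n G s)
corollary53 G a b ab v w v∈ w∈ <ᵃ >ᵇ =
  -- A minimal saturated graph is semisaturated, so it competes in the minimum defining `s`.
  (λ { n s t ((H , (_ , semi) , ∣E∣≡t) , _) (_ , s-least) → s-least (H , semi , ∣E∣≡t) }) ,
  (64 , z<s , 4 , λ { n n≥4 s ((H , semi , refl) , _) →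
    edge-bound H (semisaturated⇒reversed G H ab v∈ w∈ <ᵃ >ᵇ semi) n≥4 })
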